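{- Let $\lambda>0$ and $\mu$ be real numbers, and let $K_4-e$ be the graph obtained from the complete graph $K_4$ by removing one edge. The multiset $\{0, \lambda,\lambda, \mu\}$ is Laplacian realizable for $K_4 - e$ if and only if $\mu > 2\lambda$ or $0 < \mu \leq \frac{1}{2}\lambda$.
   Context: For a finite simple graph $G$ on $n$ vertices, $\mathcal{S}_L(G)$ denotes the set of $n\times n$ real symmetric matrices $A=[a_{i,j}]$ such that $a_{i,j}<0$ if $\{i,j\}\in E(G)$, $a_{i,j}=0$ if $i\neq j$ and $\{i,j\}\notin E(G)$, and $a_{i,i}=-\sum_{k\neq i}a_{i,k}$ for all $i$. A multiset of $n$ real numbers is Laplacian realizable for $G$ if it is the spectrum (multiset of eigenvalues) of some $A\in\mathcal{S}_L(G)$. -}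

module Defs where

open import Algebra.Bundles using (CommutativeRing; Semiring)
open import Data.Bool.Base using (if_then_else_)
open import Data.Fin.Base using (Fin; zero; suc; toℕ; punchIn)
open import Data.Fin.Properties using (_≟_)
open import Data.Nat.Base using (ℕ; zero; suc)
open import Data.Product.Base using (∃; _×_; _,_)
open import Data.Sum.Base using (_⊎_; inj₁; inj₂)
open import Data.Vec.Functional using (Vector)
open import Function.Base using (_∘_)
open import Level using (Level; 0ℓ; _⊔_) renaming (suc to lsuc)
open import Relation.Binary.Core using (Rel)
open import Relation.Binary.Definitions using (Decidable; Irreflexive; Symmetric)
open import Relation.Binary.PropositionalEquality.Core using (_≡_; _≢_; sym)
open import Relation.Binary.Structures using (IsStrictTotalOrder)
open import Relation.Nullary.Decidable.Core using (does; ¬?; _×-dec_; _⊎-dec_)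
open import Relation.Nullary.Negation.Core using (¬_)
open import Relation.Unary using (Pred; Satisfiable)

import Algebra.Definitions.RawSemiring as RawSemiringDefinitions
import Relation.Binary.Construct.StrictToNonStrict as StrictToNonStrict

-- The real numbers, given by the classical axioms that determine them up to
-- isomorphism: a totally ordered field in which every nonempty subset that is
-- bounded above has a least upper bound.
record CompleteOrderedField (c ℓ₁ ℓ₂ : Level) : Set (lsuc (c ⊔ ℓ₁ ⊔ ℓ₂)) where
  field
    commutativeRing : CommutativeRing c ℓ₁

  open CommutativeRing commutativeRing public

  infix 8 _⁻¹
  infix 4 _<_

  -- The inverse is a total function; the axioms leave 0# ⁻¹ unspecified.
  field
    1≉0         : ¬ (1# ≈ 0#)
    _⁻¹         : Carrier → Carrier
    ⁻¹-cong     : ∀ {x y} → x ≈ y → x ⁻¹ ≈ y ⁻¹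
    ⁻¹-inverseʳ : ∀ x → ¬ (x ≈ 0#) → x * x ⁻¹ ≈ 1#

    _<_                : Rel Carrier ℓ₂
    isStrictTotalOrder : IsStrictTotalOrder _≈_ _<_
    +-monoˡ-<          : ∀ z {x y} → x < y → x + z < y + z
    *-pos              : ∀ {x y} → 0# < x → 0# < y → 0# < x * y

  open StrictToNonStrict _≈_ _<_ public using (_≤_)

  UpperBound : ∀ {p} → Pred Carrier p → Pred Carrier (c ⊔ ℓ₁ ⊔ ℓ₂ ⊔ p)
  UpperBound P b = ∀ {x} → P x → x ≤ b

  field
    sup : (P : Pred Carrier (c ⊔ ℓ₁ ⊔ ℓ₂)) → Satisfiable P → ∃ (UpperBound P) →
          ∃ λ s → UpperBound P s × (∀ {b} → UpperBound P b → s ≤ b)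

  2# : Carrier
  2# = 1# + 1#

record SimpleGraph (n : ℕ) : Set₁ where
  field
    Adj    : Rel (Fin n) 0ℓ
    adj?   : Decidable Adj
    symm   : Symmetric Adj
    irrefl : Irreflexive _≡_ Adj

complete : ∀ n → SimpleGraph n
complete n = record
  { Adj    = _≢_
  ; adj?   = λ i j → ¬? (i ≟ j)
  ; symm   = λ i≢j j≡i → i≢j (sym j≡i)
  ; irrefl = λ i≡j i≢j → i≢j i≡j
  }

-- {i , j} and {u , v} are equal as unordered pairs.
SamePair : ∀ {n} → Fin n → Fin n → Fin n → Fin n → Set
SamePair u v i j = (i ≡ u × j ≡ v) ⊎ (i ≡ v × j ≡ u)

deleteEdge : ∀ {n} → SimpleGraph n → Fin n → Fin n → SimpleGraph n
deleteEdge G u v = record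
  { Adj    = λ i j → Adj i j × ¬ SamePair u v i j
  ; adj?   = λ i j → adj? i j ×-dec
               ¬? ((i ≟ u ×-dec j ≟ v) ⊎-dec (i ≟ v ×-dec j ≟ u))
  ; symm   = λ (a , ne) → symm a , ne ∘ swapPair
  ; irrefl = λ i≡j (a , _) → irrefl i≡j a
  }
  where
  open SimpleGraph G
  swapPair : ∀ {i j} → SamePair u v j i → SamePair u v i j
  swapPair (inj₁ (p , q)) = inj₂ (q , p)
  swapPair (inj₂ (p , q)) = inj₁ (q , p)

-- All choices of the deleted edge give isomorphic graphs.
K₄-e : SimpleGraph 4
K₄-e = deleteEdge (complete 4) zero (suc zero)

module _ {c ℓ₁ ℓ₂} (ℝ : CompleteOrderedField c ℓ₁ ℓ₂) where
  open CompleteOrderedField ℝ hiding (zero)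
  open RawSemiringDefinitions (Semiring.rawSemiring semiring) using (sum; product; _^_)

  Matrix : ℕ → Set c
  Matrix n = Fin n → Fin n → Carrier

  -- Laplace expansion along the first row.
  det : ∀ {n} → Matrix n → Carrier
  det {zero}  M = 1#
  det {suc n} M = sum λ j →
    (- 1#) ^ toℕ j * M zero j * det (λ i k → M (suc i) (punchIn j k))

  scalar : ∀ {n} → Carrier → Matrix n
  scalar x i j = if does (i ≟ j) then x else 0#

  charPoly : ∀ {n} → Matrix n → Carrier → Carrier
  charPoly A x = det λ i j → scalar x i j - A i j

  -- The entries of σ, in any order and with repetitions, are the eigenvalues
  -- of A with multiplicity: the characteristic polynomial is ∏ᵢ (x - σᵢ).
  -- Over an infinite field, equality of polynomials is equality of their values.
  IsSpectrum : ∀ {n} → Matrix n → Vector Carrier n → Set (c ⊔ ℓ₁)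
  IsSpectrum A σ = ∀ x → charPoly A x ≈ product λ i → x - σ i

  record 𝒮ᴸ {n} (G : SimpleGraph n) (A : Matrix n) : Set (c ⊔ ℓ₁ ⊔ ℓ₂) where
    open SimpleGraph G
    field
      symmetric : ∀ i j → A i j ≈ A j i
      edge      : ∀ {i j} → Adj i j → A i j < 0#
      nonEdge   : ∀ {i j} → i ≢ j → ¬ Adj i j → A i j ≈ 0#
      diagonal  : ∀ i → A i i ≈ - sum λ k → if does (k ≟ i) then 0# else A i k

  LaplacianRealizable : ∀ {n} → SimpleGraph n → Vector Carrier n → Set (c ⊔ ℓ₁ ⊔ ℓ₂)
  LaplacianRealizable G σ = ∃ λ A → 𝒮ᴸ G A × IsSpectrum A σ

{-# OPTIONS --safe #-}
module Submission where

-- Besides 0, the spectrum is that of a symmetric 3 × 3 matrix C, the compression of the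
-- Laplacian to (1,1,1,1)^⟂. If λ is a double eigenvalue, then D = C - λ has rank at most one,
-- and since the sum of the squares of the 2 × 2 minors of D is a polynomial in the
-- coefficients of its characteristic polynomial, all these minors vanish. So D₂₂ D₃₃ = e², where
-- e > 0 is the weight of the edge joining the two vertices of degree three. If D₂₂ and D₃₃ are
-- positive, then D₂₂ + D₃₃ ≥ 2 e gives μ > 2 λ; if they are negative, then D₁₁ ≤ 0 as well and
-- - D₂₂ - D₃₃ ≥ 2 e gives 2 μ ≤ λ, while μ > 0 by Kirchhoff's theorem. Conversely, λ and μ in
-- the given range are realized by explicit weights involving one square root, which exists
-- because the supremum of {x | x² ≤ y} squares to y.

open import Defs
open import Algebra.Bundles using (CommutativeRing; Semiring)
open import Algebra.Solver.Ring.AlmostCommutativeRing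
  using (fromCommutativeRing; _-Raw-AlmostCommutative⟶_)
open import Data.Bool.Base using (if_then_else_)
open import Data.Fin.Base as Fin using (Fin; zero; suc; punchIn)
open import Data.Fin.Patterns using (0F; 1F; 2F; 3F)
open import Data.Fin.Properties as Finₚ using (_≟_)
open import Data.Integer.Base as ℤ using (ℤ; +_; -[1+_]; +[1+_])
open import Data.Maybe.Base using (map)
open import Data.Nat.Base as ℕ using (ℕ; zero; suc)
open import Data.Product.Base using (∃; _×_; _,_; proj₁; proj₂)
open import Data.Sum.Base using (_⊎_; inj₁; inj₂; [_,_]′; map₂)
open import Data.Vec.Functional using (_∷_; [])
open import Function.Bundles using (_⇔_; mk⇔)
open import Level using (_⊔_; Lift; lift)
open import Relation.Binary.Definitions using (tri<; tri≈; tri>)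
open import Relation.Binary.PropositionalEquality as ≡ using (_≢_)
open import Relation.Binary.Structures using (IsStrictTotalOrder; IsTotalOrder)
open import Relation.Nullary.Decidable.Core using (does; yes; no; from-yes; from-no; dec⇒maybe)
open import Relation.Nullary.Negation.Core using (¬_; contradiction)

import Algebra.Definitions.RawSemiring as RawSemiringDefinitions
import Algebra.Properties.AbelianGroup as AbelianGroupProperties
import Algebra.Properties.Monoid.Sum as MonoidSum
import Algebra.Properties.Ring as RingProperties
import Algebra.Properties.Semiring.Mult.TCOptimised as SemiringMult
import Algebra.Solver.Ring as RingSolver
import Data.Integer.Properties as ℤₚ
import Data.Nat.Properties as ℕₚ
import Relation.Binary.Construct.StrictToNonStrict as StrictToNonStrict
import Relation.Binary.Reasoning.Setoid as SetoidReasoning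

-- Polynomial identities with integer coefficients.

-- The ring solver with coefficients in ℤ rather than in the abstract ring, whose
-- equality is undecidable: integer coefficients cancel by computation.
module IntegerCoefficients {c ℓ} (R : CommutativeRing c ℓ) where
  open CommutativeRing R
  open AbelianGroupProperties +-abelianGroup
    using (⁻¹-∙-comm) renaming (⁻¹-involutive to -‿involutive; ε⁻¹≈ε to -0≈0)
  open RingProperties ring using (-‿distribˡ-*; -‿distribʳ-*)
  open SemiringMult semiring using (×-homo-+; ×1-homo-*; 1+×) renaming (_×_ to _·_)
  open SetoidReasoning setoid

  -- With this form of multiplication `1 · 1#` reduces to `1#` and `2 · 1#` to `1# + 1#`. The solver
  -- constants `:1` and `:2` thus evaluate definitionally to `1#` and `2#`, and solved identities
  -- fit the goals directly.
  ⟦_⟧ᶻ : ℤ → Carrier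
  ⟦ + n ⟧ᶻ      = n · 1#
  ⟦ -[1+ n ] ⟧ᶻ = - (suc n · 1#)

  -- A common 1 is cancelled from both numbers until one of them is zero. This settles the sums of
  -- mixed sign in `+-homo`.
  ⊖-homo : ∀ m n → ⟦ m ℤ.⊖ n ⟧ᶻ ≈ m · 1# - n · 1#
  ⊖-homo m zero = begin
    m · 1#         ≈⟨ +-identityʳ _ ⟨
    m · 1# + 0#    ≈⟨ +-congˡ -0≈0 ⟨
    m · 1# + - 0#  ∎
  ⊖-homo zero (suc n) = sym (+-identityˡ _)
  ⊖-homo (suc m) (suc n) = begin
    ⟦ suc m ℤ.⊖ suc n ⟧ᶻ                       ≡⟨ ≡.cong ⟦_⟧ᶻ (ℤₚ.[1+m]⊖[1+n]≡m⊖n m n) ⟩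
    ⟦ m ℤ.⊖ n ⟧ᶻ                               ≈⟨ ⊖-homo m n ⟩
    m · 1# - n · 1#                            ≈⟨ +-congʳ (+-identityˡ _) ⟨
    0# + m · 1# - n · 1#                       ≈⟨ +-congʳ (+-congʳ (-‿inverseʳ 1#)) ⟨
    1# - 1# + m · 1# - n · 1#                  ≈⟨ +-congʳ (+-assoc _ _ _) ⟩
    1# + (- 1# + m · 1#) - n · 1#              ≈⟨ +-congʳ (+-congˡ (+-comm _ _)) ⟩
    1# + (m · 1# - 1#) - n · 1#                ≈⟨ +-congʳ (+-assoc _ _ _) ⟨
    1# + m · 1# - 1# - n · 1#                  ≈⟨ +-assoc _ _ _ ⟩
    1# + m · 1# + (- 1# - n · 1#)              ≈⟨ +-congˡ (⁻¹-∙-comm _ _) ⟩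
    1# + m · 1# - (1# + n · 1#)                ≈⟨ +-cong (1+× m 1#) (-‿cong (1+× n 1#)) ⟨
    suc m · 1# - suc n · 1#                    ∎

  -‿homo : ∀ i → ⟦ ℤ.- i ⟧ᶻ ≈ - ⟦ i ⟧ᶻ
  -‿homo (+ zero)  = sym -0≈0
  -‿homo +[1+ n ]  = refl
  -‿homo -[1+ n ]  = sym (-‿involutive _)

  +-homo : ∀ i j → ⟦ i ℤ.+ j ⟧ᶻ ≈ ⟦ i ⟧ᶻ + ⟦ j ⟧ᶻ
  +-homo (+ m)    (+ n)    = ×-homo-+ 1# m n
  +-homo (+ m)    -[1+ n ] = ⊖-homo m (suc n)
  +-homo -[1+ m ] (+ n)    = trans (⊖-homo n (suc m)) (+-comm _ _)
  +-homo -[1+ m ] -[1+ n ] = begin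
    - (suc (suc (m ℕ.+ n)) · 1#)        ≡⟨ ≡.cong (λ k → - (suc k · 1#)) (ℕₚ.+-suc m n) ⟨
    - ((suc m ℕ.+ suc n) · 1#)          ≈⟨ -‿cong (×-homo-+ 1# (suc m) (suc n)) ⟩
    - (suc m · 1# + suc n · 1#)         ≈⟨ ⁻¹-∙-comm _ _ ⟨
    - (suc m · 1#) - suc n · 1#         ∎

  *-homo-+ : ∀ m n → ⟦ + m ℤ.* + n ⟧ᶻ ≈ (m · 1#) * (n · 1#)
  *-homo-+ m n = begin
    ⟦ + m ℤ.* + n ⟧ᶻ     ≡⟨ ≡.cong ⟦_⟧ᶻ (ℤₚ.pos-* m n) ⟨
    (m ℕ.* n) · 1#       ≈⟨ ×1-homo-* m n ⟩
    (m · 1#) * (n · 1#)  ∎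

  *-homo : ∀ i j → ⟦ i ℤ.* j ⟧ᶻ ≈ ⟦ i ⟧ᶻ * ⟦ j ⟧ᶻ
  *-homo (+ m) (+ n) = *-homo-+ m n
  *-homo (+ m) -[1+ n ] = begin
    ⟦ + m ℤ.* -[1+ n ] ⟧ᶻ       ≡⟨ ≡.cong ⟦_⟧ᶻ (ℤₚ.neg-distribʳ-* (+ m) +[1+ n ]) ⟨
    ⟦ ℤ.- (+ m ℤ.* +[1+ n ]) ⟧ᶻ ≈⟨ -‿homo (+ m ℤ.* +[1+ n ]) ⟩
    - ⟦ + m ℤ.* +[1+ n ] ⟧ᶻ     ≈⟨ -‿cong (*-homo-+ m (suc n)) ⟩
    - ((m · 1#) * (suc n · 1#)) ≈⟨ -‿distribʳ-* _ _ ⟩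
    (m · 1#) * - (suc n · 1#)   ∎
  *-homo -[1+ m ] (+ n) = begin
    ⟦ -[1+ m ] ℤ.* + n ⟧ᶻ       ≡⟨ ≡.cong ⟦_⟧ᶻ (ℤₚ.neg-distribˡ-* +[1+ m ] (+ n)) ⟨
    ⟦ ℤ.- (+[1+ m ] ℤ.* + n) ⟧ᶻ ≈⟨ -‿homo (+[1+ m ] ℤ.* + n) ⟩
    - ⟦ +[1+ m ] ℤ.* + n ⟧ᶻ     ≈⟨ -‿cong (*-homo-+ (suc m) n) ⟩
    - ((suc m · 1#) * (n · 1#)) ≈⟨ -‿distribˡ-* _ _ ⟩
    - (suc m · 1#) * (n · 1#)   ∎
  *-homo -[1+ m ] -[1+ n ] = begin
    ⟦ -[1+ m ] ℤ.* -[1+ n ] ⟧ᶻ       ≈⟨ *-homo-+ (suc m) (suc n) ⟩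
    (suc m · 1#) * (suc n · 1#)      ≈⟨ -‿involutive _ ⟨
    - - ((suc m · 1#) * (suc n · 1#)) ≈⟨ -‿cong (-‿distribʳ-* _ _) ⟩
    - ((suc m · 1#) * - (suc n · 1#)) ≈⟨ -‿distribˡ-* _ _ ⟩
    - (suc m · 1#) * - (suc n · 1#)   ∎

  homomorphism : ℤ.+-*-rawRing -Raw-AlmostCommutative⟶ fromCommutativeRing R
  homomorphism = record
    { ⟦_⟧    = ⟦_⟧ᶻ
    ; +-homo = +-homo
    ; *-homo = *-homo
    ; -‿homo = -‿homo
    ; 0-homo = refl
    ; 1-homo = refl
    }

  open RingSolver ℤ.+-*-rawRing (fromCommutativeRing R) homomorphism
    (λ i j → map (λ i≡j → reflexive (≡.cong ⟦_⟧ᶻ i≡j)) (dec⇒maybe (i ℤₚ.≟ j))) public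
    using (Polynomial; solve; _:=_; _:+_; _:*_; _:-_; :-_; con)

  3# 4# 6# 8# : Carrier
  3# = ⟦ + 3 ⟧ᶻ
  4# = ⟦ + 4 ⟧ᶻ
  6# = ⟦ + 6 ⟧ᶻ
  8# = ⟦ + 8 ⟧ᶻ

  :0 :1 :2 :3 :4 :6 :8 : ∀ {n} → Polynomial n
  :0 = con (+ 0)
  :1 = con (+ 1)
  :2 = con (+ 2)
  :3 = con (+ 3)
  :4 = con (+ 4)
  :6 = con (+ 6)
  :8 = con (+ 8)

module _ {ℓ ℓ₁ ℓ₂} (ℝ : CompleteOrderedField ℓ ℓ₁ ℓ₂) where
  open CompleteOrderedField ℝ hiding (zero)
  open IntegerCoefficients commutativeRing
  open IsStrictTotalOrder isStrictTotalOrder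
    using (compare; <-respʳ-≈; <-respˡ-≈; irrefl) renaming (trans to <-trans)
  private module ≤ = StrictToNonStrict _≈_ _<_
  open IsTotalOrder (≤.isTotalOrder isStrictTotalOrder) using () renaming (trans to ≤-trans)
  open SetoidReasoning setoid

  open AbelianGroupProperties +-abelianGroup
    using () renaming (x∙y⁻¹≈ε⇒x≈y to x-y≈0⇒x≈y; ⁻¹-involutive to -‿involutive)

  -- Signs, products and squares in an ordered field.

  <-≤-trans : ∀ {x y z} → x < y → y ≤ z → x < z
  <-≤-trans = ≤.<-≤-trans <-trans <-respʳ-≈

  0<-resp : ∀ {x y} → x ≈ y → 0# < x → 0# < y
  0<-resp = <-respʳ-≈

  0≤-resp : ∀ {x y} → x ≈ y → 0# ≤ x → 0# ≤ y
  0≤-resp x≈y (inj₁ 0<x) = inj₁ (0<-resp x≈y 0<x)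
  0≤-resp x≈y (inj₂ 0≈x) = inj₂ (trans 0≈x x≈y)

  x<y⇒0<y-x : ∀ {x y} → x < y → 0# < y - x
  x<y⇒0<y-x {x} x<y = <-respˡ-≈ (-‿inverseʳ x) (+-monoˡ-< (- x) x<y)

  0<y-x⇒x<y : ∀ {x y} → 0# < y - x → x < y
  0<y-x⇒x<y {x} {y} 0<y-x =
    <-respˡ-≈ (+-identityˡ x)
      (<-respʳ-≈ (solve 2 (λ x y → y :- x :+ x := y) refl x y) (+-monoˡ-< x 0<y-x))

  x≤y⇒0≤y-x : ∀ {x y} → x ≤ y → 0# ≤ y - x
  x≤y⇒0≤y-x (inj₁ x<y) = inj₁ (x<y⇒0<y-x x<y)
  x≤y⇒0≤y-x {x} {y} (inj₂ x≈y) = inj₂ (trans (sym (-‿inverseʳ x)) (+-congʳ x≈y))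

  0≤y-x⇒x≤y : ∀ {x y} → 0# ≤ y - x → x ≤ y
  0≤y-x⇒x≤y (inj₁ 0<y-x) = inj₁ (0<y-x⇒x<y 0<y-x)
  0≤y-x⇒x≤y {x} {y} (inj₂ 0≈y-x) = inj₂ (sym (x-y≈0⇒x≈y y x (sym 0≈y-x)))

  <⇒≱ : ∀ {x y} → x < y → ¬ (y ≤ x)
  <⇒≱ x<y (inj₁ y<x) = irrefl refl (<-trans x<y y<x)
  <⇒≱ x<y (inj₂ y≈x) = irrefl (sym y≈x) x<y

  <-≤-connex : ∀ x y → x < y ⊎ y ≤ x
  <-≤-connex x y with compare x y
  ... | tri< x<y _ _ = inj₁ x<y
  ... | tri≈ _ x≈y _ = inj₂ (inj₂ (sym x≈y))
  ... | tri> _ _ y<x = inj₂ (inj₁ y<x)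

  +-pos : ∀ {x y} → 0# < x → 0# < y → 0# < x + y
  +-pos {x} {y} 0<x 0<y = <-trans 0<y (<-respˡ-≈ (+-identityˡ y) (+-monoˡ-< y 0<x))

  +-pos-nonneg : ∀ {x y} → 0# < x → 0# ≤ y → 0# < x + y
  +-pos-nonneg 0<x (inj₁ 0<y) = +-pos 0<x 0<y
  +-pos-nonneg {x} 0<x (inj₂ 0≈y) = 0<-resp (trans (sym (+-identityʳ x)) (+-congˡ 0≈y)) 0<x

  +-nonneg : ∀ {x y} → 0# ≤ x → 0# ≤ y → 0# ≤ x + y
  +-nonneg (inj₁ 0<x) 0≤y = inj₁ (+-pos-nonneg 0<x 0≤y)
  +-nonneg {x} {y} (inj₂ 0≈x) 0≤y = 0≤-resp (trans (sym (+-identityˡ y)) (+-congʳ 0≈x)) 0≤y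

  *-nonneg : ∀ {x y} → 0# ≤ x → 0# ≤ y → 0# ≤ x * y
  *-nonneg (inj₁ 0<x) (inj₁ 0<y) = inj₁ (*-pos 0<x 0<y)
  *-nonneg {x} (inj₁ _) (inj₂ 0≈y) = inj₂ (trans (sym (zeroʳ x)) (*-congˡ 0≈y))
  *-nonneg {x} {y} (inj₂ 0≈x) _ = inj₂ (trans (sym (zeroˡ y)) (*-congʳ 0≈x))

  neg⇒0<- : ∀ {x} → x < 0# → 0# < - x
  neg⇒0<- {x} x<0 = 0<-resp (+-identityˡ (- x)) (x<y⇒0<y-x x<0)

  square-pos : ∀ {x} → ¬ (x ≈ 0#) → 0# < x * x
  square-pos {x} x≉0 with compare 0# x
  ... | tri< 0<x _ _ = *-pos 0<x 0<x
  ... | tri≈ _ 0≈x _ = contradiction (sym 0≈x) x≉0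
  ... | tri> _ _ x<0 =
    0<-resp (solve 1 (λ x → :- x :* :- x := x :* x) refl x) (*-pos (neg⇒0<- x<0) (neg⇒0<- x<0))

  square-nonneg : ∀ x → 0# ≤ x * x
  square-nonneg x with compare x 0#
  ... | tri< _ x≉0 _ = inj₁ (square-pos x≉0)
  ... | tri≈ _ x≈0 _ = inj₂ (sym (trans (*-congˡ x≈0) (zeroʳ x)))
  ... | tri> _ x≉0 _ = inj₁ (square-pos x≉0)

  0<1 : 0# < 1#
  0<1 = 0<-resp (*-identityˡ 1#) (square-pos 1≉0)

  0<2 : 0# < 2#
  0<2 = +-pos 0<1 0<1

  0<4 : 0# < 4#
  0<4 = +-pos (+-pos 0<2 0<1) 0<1

  *-cancel-pos : ∀ {x y} → 0# < x → 0# < x * y → 0# < y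
  *-cancel-pos {x} {y} 0<x 0<xy with compare 0# y
  ... | tri< 0<y _ _ = 0<y
  ... | tri≈ _ 0≈y _ = contradiction 0<xy (irrefl (trans (sym (zeroʳ x)) (*-congˡ 0≈y)))
  ... | tri> _ _ y<0 = contradiction (*-pos 0<x (neg⇒0<- y<0))
    (λ 0<x*-y → irrefl (sym (solve 2 (λ x y → x :* y :+ x :* :- y := :0) refl x y))
      (+-pos 0<xy 0<x*-y))

  *-cancel-nonneg : ∀ {x y} → 0# < x → 0# ≤ x * y → 0# ≤ y
  *-cancel-nonneg {x} {y} 0<x 0≤xy with <-≤-connex y 0#
  ... | inj₂ 0≤y = 0≤y
  ... | inj₁ y<0 = contradiction
    (+-pos-nonneg (*-pos 0<x (neg⇒0<- y<0)) 0≤xy)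
    (irrefl (sym (solve 2 (λ x y → x :* :- y :+ x :* y := :0) refl x y)))

  nonneg-antisym : ∀ {x} → 0# ≤ x → 0# ≤ - x → x ≈ 0#
  nonneg-antisym (inj₂ 0≈x) _ = sym 0≈x
  nonneg-antisym {x} (inj₁ 0<x) 0≤-x =
    contradiction (+-pos-nonneg 0<x 0≤-x) (irrefl (sym (-‿inverseʳ x)))

  *-cancel-zero : ∀ {x y} → 0# < x → x * y ≈ 0# → y ≈ 0#
  *-cancel-zero {x} {y} 0<x xy≈0 = nonneg-antisym
    (*-cancel-nonneg 0<x (inj₂ (sym xy≈0)))
    (*-cancel-nonneg 0<x (inj₂ (sym (trans
      (solve 2 (λ x y → x :* :- y := :0 :- x :* y) refl x y)
      (trans (+-congˡ (-‿cong xy≈0)) (-‿inverseʳ 0#))))))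

  square≈0⇒≈0 : ∀ {x} → x * x ≈ 0# → x ≈ 0#
  square≈0⇒≈0 {x} x²≈0 with compare x 0#
  ... | tri< _ x≉0 _ = contradiction (square-pos x≉0) (irrefl (sym x²≈0))
  ... | tri≈ _ x≈0 _ = x≈0
  ... | tri> _ x≉0 _ = contradiction (square-pos x≉0) (irrefl (sym x²≈0))

  nonneg-sum≈0 : ∀ {x y} → 0# ≤ x → 0# ≤ y → x + y ≈ 0# → x ≈ 0#
  nonneg-sum≈0 {x} {y} 0≤x 0≤y x+y≈0 = nonneg-antisym 0≤x
    (0≤-resp (trans (solve 2 (λ x y → y := x :+ y :- x) refl x y)
      (trans (+-congʳ x+y≈0) (+-identityˡ (- x)))) 0≤y)

  square-cancel-≤ : ∀ {x y} → 0# < y → x * x ≤ y * y → x ≤ y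
  square-cancel-≤ {x} {y} 0<y x²≤y² with <-≤-connex y x
  ... | inj₂ x≤y = x≤y
  ... | inj₁ y<x = contradiction x²≤y² (<⇒≱ (0<y-x⇒x<y (0<-resp
    -- The factor x + y is written as (x - y) + 2 y, a sum of terms known to be positive; no sign of
    -- x is assumed.
    (solve 2 (λ x y → (x :- y) :* (x :- y :+ (y :+ y)) := x :* x :- y :* y) refl x y)
    (*-pos 0<x-y (+-pos 0<x-y (+-pos 0<y 0<y))))))
    where 0<x-y = x<y⇒0<y-x y<x

  -- Division and square roots.

  *-inverse-pos : ∀ {x} → 0# < x → x * x ⁻¹ ≈ 1#
  *-inverse-pos {x} 0<x = ⁻¹-inverseʳ x (λ x≈0 → irrefl (sym x≈0) 0<x)

  quotient : ∀ {x} → 0# < x → ∀ y → ∃ λ z → x * z ≈ y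
  quotient {x} 0<x y = x ⁻¹ * y , trans (sym (*-assoc x (x ⁻¹) y))
    (trans (*-congʳ (*-inverse-pos 0<x)) (*-identityˡ y))

  -- The arithmetic mean of s and y / s.
  newton : ∀ {s y} → 0# < s → 0# < y →
    ∃ λ n → 0# < n × y ≤ n * n × (y < s * s → n < s)
  newton {s} {y} 0<s 0<y with quotient (*-pos 0<2 0<s) (s * s + y)
  ... | n , 2sn≈s²+y = n , 0<n , 0≤y-x⇒x≤y (*-cancel-nonneg (*-pos 0<2s 0<2s) above) ,
    λ y<s² → 0<y-x⇒x<y (*-cancel-pos 0<2s (below (x<y⇒0<y-x y<s²)))
    where
    0<2s = *-pos 0<2 0<s
    0<n = *-cancel-pos 0<2s (0<-resp (sym 2sn≈s²+y) (+-pos (*-pos 0<s 0<s) 0<y))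
    above : 0# ≤ 2# * s * (2# * s) * (n * n - y)
    above = 0≤-resp (begin
      (s * s - y) * (s * s - y)
        ≈⟨ solve 2 (λ s y → (s :* s :- y) :* (s :* s :- y) :=
             (s :* s :+ y) :* (s :* s :+ y) :- :4 :* (s :* s) :* y) refl s y ⟩
      (s * s + y) * (s * s + y) - 4# * (s * s) * y
        ≈⟨ +-congʳ (*-cong 2sn≈s²+y 2sn≈s²+y) ⟨
      2# * s * n * (2# * s * n) - 4# * (s * s) * y
        ≈⟨ solve 3 (λ s y n → :2 :* s :* n :* (:2 :* s :* n) :- :4 :* (s :* s) :* y :=
             :2 :* s :* (:2 :* s) :* (n :* n :- y)) refl s y n ⟩
      2# * s * (2# * s) * (n * n - y) ∎)
      (square-nonneg _)
    below : 0# < s * s - y → 0# < 2# * s * (s - n)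
    below = 0<-resp (begin
      s * s - y
        ≈⟨ solve 2 (λ s y → s :* s :- y := :2 :* s :* s :- (s :* s :+ y)) refl s y ⟩
      2# * s * s - (s * s + y)
        ≈⟨ +-congˡ (-‿cong 2sn≈s²+y) ⟨
      2# * s * s - 2# * s * n
        ≈⟨ solve 3 (λ t s n → t :* s :- t :* n := t :* (s :- n)) refl (2# * s) s n ⟩
      2# * s * (s - n) ∎)

  -- The harmonic mean of s and y / s.
  harmonic : ∀ {s y} → 0# < s → 0# < y →
    ∃ λ h → 0# < h × h * h ≤ y × (s * s < y → s < h)
  harmonic {s} {y} 0<s 0<y with quotient (+-pos (*-pos 0<s 0<s) 0<y) (2# * s * y)
  ... | h , th≈2sy = h , 0<h , 0≤y-x⇒x≤y (*-cancel-nonneg (*-pos 0<t 0<t) below) ,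
    λ s²<y → 0<y-x⇒x<y (*-cancel-pos 0<t (above (*-pos 0<s (x<y⇒0<y-x s²<y))))
    where
    0<t = +-pos (*-pos 0<s 0<s) 0<y
    0<h = *-cancel-pos 0<t (0<-resp (sym th≈2sy) (*-pos (*-pos 0<2 0<s) 0<y))
    below : 0# ≤ (s * s + y) * (s * s + y) * (y - h * h)
    below = 0≤-resp (begin
      y * ((s * s - y) * (s * s - y))
        ≈⟨ solve 2 (λ s y → y :* ((s :* s :- y) :* (s :* s :- y)) :=
             (s :* s :+ y) :* (s :* s :+ y) :* y :-
             :2 :* s :* y :* (:2 :* s :* y)) refl s y ⟩
      (s * s + y) * (s * s + y) * y - 2# * s * y * (2# * s * y)
        ≈⟨ +-congˡ (-‿cong (*-cong th≈2sy th≈2sy)) ⟨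
      (s * s + y) * (s * s + y) * y - (s * s + y) * h * ((s * s + y) * h)
        ≈⟨ solve 3 (λ t y h → t :* t :* y :- t :* h :* (t :* h) :=
             t :* t :* (y :- h :* h)) refl (s * s + y) y h ⟩
      (s * s + y) * (s * s + y) * (y - h * h) ∎)
      (*-nonneg (inj₁ 0<y) (square-nonneg _))
    above : 0# < s * (y - s * s) → 0# < (s * s + y) * (h - s)
    above = 0<-resp (begin
      s * (y - s * s)
        ≈⟨ solve 2 (λ s y → s :* (y :- s :* s) :=
             :2 :* s :* y :- (s :* s :+ y) :* s) refl s y ⟩
      2# * s * y - (s * s + y) * s
        ≈⟨ +-congʳ th≈2sy ⟨
      (s * s + y) * h - (s * s + y) * s
        ≈⟨ solve 3 (λ t h s → t :* h :- t :* s := t :* (h :- s)) refl (s * s + y) h s ⟩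
      (s * s + y) * (h - s) ∎)

  module _ {y : Carrier} (0<y : 0# < y) where
    private
      -- The lift raises the predicate to the level at which `sup` is stated.
      SquareBelow : Carrier → Set (ℓ ⊔ ℓ₁ ⊔ ℓ₂)
      SquareBelow x = Lift (ℓ ⊔ ℓ₁ ⊔ ℓ₂) (x * x ≤ y)

      above : ∀ {n} → 0# < n → y ≤ n * n → UpperBound SquareBelow n
      above 0<n y≤n² (lift x²≤y) = square-cancel-≤ 0<n (≤-trans x²≤y y≤n²)

    -- If s² < y, the harmonic mean is a larger number whose square is still at most y, so s is no
    -- upper bound. If s² > y, the arithmetic mean is a smaller upper bound, so s is not least.
    supremum-squared : ∀ {s} → 0# < s → UpperBound SquareBelow s →
                       (∀ {b} → UpperBound SquareBelow b → s ≤ b) → s * s ≈ y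
    supremum-squared {s} 0<s s-upper s-least with compare (s * s) y
    ... | tri≈ _ s²≈y _ = s²≈y
    ... | tri< s²<y _ _ =
      let h , _ , h²≤y , s<h = harmonic 0<s 0<y
      in contradiction (s-upper (lift h²≤y)) (<⇒≱ (s<h s²<y))
    ... | tri> _ _ y<s² =
      let n , 0<n , y≤n² , n<s = newton 0<s 0<y
      in contradiction (s-least (above 0<n y≤n²)) (<⇒≱ (n<s y<s²))

    sqrt-pos : ∃ λ r → 0# < r × r * r ≈ y
    sqrt-pos =
      -- The harmonic and arithmetic means of 1 and y give a positive element of the set and an
      -- upper bound. The positive element also makes the supremum positive.
      let h , 0<h , h²≤y , _ = harmonic 0<1 0<y
          n , 0<n , y≤n² , _ = newton 0<1 0<y
          s , s-upper , s-least = sup SquareBelow (h , lift h²≤y) (n , above 0<n y≤n²)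
          0<s = <-≤-trans 0<h (s-upper (lift h²≤y))
      in s , 0<s , supremum-squared 0<s s-upper s-least

  -- The root of zero is needed at the endpoint μ = l/2 of the small range.
  sqrt : ∀ {y} → 0# ≤ y → ∃ λ r → 0# ≤ r × r * r ≈ y
  sqrt (inj₁ 0<y) = let r , 0<r , r²≈y = sqrt-pos 0<y in r , inj₁ 0<r , r²≈y
  sqrt (inj₂ 0≈y) = 0# , inj₂ refl , trans (zeroˡ 0#) 0≈y

  -- The characteristic polynomial of the weighted Laplacian.

  -- The nonadjacent vertices are 0 and 1. The weights a, b join 0 to 2, 3, the weights c, d join 1
  -- to 2, 3, and e joins the two vertices of degree three.
  laplacian : (a b c d e : Carrier) → Matrix ℝ 4
  laplacian a b c d e 0F 0F = a + b
  laplacian a b c d e 0F 1F = 0#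
  laplacian a b c d e 0F 2F = - a
  laplacian a b c d e 0F 3F = - b
  laplacian a b c d e 1F 0F = 0#
  laplacian a b c d e 1F 1F = c + d
  laplacian a b c d e 1F 2F = - c
  laplacian a b c d e 1F 3F = - d
  laplacian a b c d e 2F 0F = - a
  laplacian a b c d e 2F 1F = - c
  laplacian a b c d e 2F 2F = a + c + e
  laplacian a b c d e 2F 3F = - e
  laplacian a b c d e 3F 0F = - b
  laplacian a b c d e 3F 1F = - d
  laplacian a b c d e 3F 2F = - e
  laplacian a b c d e 3F 3F = b + d + e

  -- The coefficients of the characteristic polynomial of the symmetric matrix
  -- with diagonal (p, q, r) and entries u = (1,2), v = (1,3), w = (2,3).
  e₁ : (p q r : Carrier) → Carrier
  e₁ p q r = p + q + r

  e₂ e₃ : (p q r u v w : Carrier) → Carrier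
  e₂ p q r u v w = (p * q - u * u) + (p * r - v * v) + (q * r - w * w)
  e₃ p q r u v w = p * (q * r - w * w) - u * (u * r - v * w) + v * (u * w - q * v)

  module _ {n : ℕ} where
    private
      P = Polynomial n

    :e₂ :e₃ : (p q r u v w : P) → P
    :e₂ p q r u v w = (p :* q :- u :* u) :+ (p :* r :- v :* v) :+ (q :* r :- w :* w)
    :e₃ p q r u v w =
      p :* (q :* r :- w :* w) :- u :* (u :* r :- v :* w) :+ v :* (u :* w :- q :* v)

    -- The elementary symmetric functions of l, l, m. They are the targets for `:w₁`, `:w₂`, `:w₃`,
    -- the coefficients that belong to the compressed Laplacian.
    :σ₁ :σ₂ :σ₃ : (l m : P) → P
    :σ₁ l m = l :+ l :+ m
    :σ₂ l m = l :* l :+ :2 :* (l :* m)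
    :σ₃ l m = l :* l :* m

    :w₁ :w₂ :w₃ : (a b c d e : P) → P
    :w₁ a b c d e = a :+ b :+ c :+ d :+ (b :+ c :+ e) :+ (a :+ d :+ e)
    :w₂ a b c d e =
      :e₂ (a :+ b :+ c :+ d) (b :+ c :+ e) (a :+ d :+ e) (b :- c) (a :- d) (:- e)
    :w₃ a b c d e =
      :e₃ (a :+ b :+ c :+ d) (b :+ c :+ e) (a :+ d :+ e) (b :- c) (a :- d) (:- e)

    -- The unfolding of det, so that :det₄ evaluates definitionally to a value of det.
    :det₁ : P → P
    :det₁ m = :1 :* m :* :1 :+ :0

    :det₂ : (a b c d : P) → P
    :det₂ a b c d = :1 :* a :* :det₁ d :+ (:- :1 :* :1 :* b :* :det₁ c :+ :0)

    :det₃ : (a b c d e f g h i : P) → P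
    :det₃ a b c d e f g h i =
      :1 :* a :* :det₂ e f h i :+
      (:- :1 :* :1 :* b :* :det₂ d f g i :+
      (:- :1 :* (:- :1 :* :1) :* c :* :det₂ d e g h :+ :0))

    :det₄ : (a b c d e f g h i j l m n o p q : P) → P
    :det₄ a b c d e f g h i j l m n o p q =
      :1 :* a :* :det₃ f g h j l m o p q :+
      (:- :1 :* :1 :* b :* :det₃ e g h i l m n p q :+
      (:- :1 :* (:- :1 :* :1) :* c :* :det₃ e f h i j m n o q :+
      (:- :1 :* (:- :1 :* (:- :1 :* :1)) :* d :* :det₃ e f g i j l n o p :+ :0)))

  -- The compression of the Laplacian to the orthogonal complement of (1,1,1,1), in the
  -- orthonormal basis ½(1,1,-1,-1), ½(1,-1,1,-1), ½(1,-1,-1,1), is the 3 × 3 matrix with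
  -- diagonal (a + b + c + d, b + c + e, a + d + e) and entries b - c, a - d, - e.
  charPoly-laplacian : ∀ a b c d e x →
    charPoly ℝ (laplacian a b c d e) x ≈
      x * e₃ (x - (a + b + c + d)) (x - (b + c + e)) (x - (a + d + e))
             (- (b - c)) (- (a - d)) (- - e)
  charPoly-laplacian a b c d e x = solve 6
    (λ a b c d e x →
      let o = :0 in
      :det₄ (x :- (a :+ b)) (o :- o) (o :- (:- a)) (o :- (:- b))
            (o :- o) (x :- (c :+ d)) (o :- (:- c)) (o :- (:- d))
            (o :- (:- a)) (o :- (:- c)) (x :- (a :+ c :+ e)) (o :- (:- e))
            (o :- (:- b)) (o :- (:- d)) (o :- (:- e)) (x :- (b :+ d :+ e))
       := x :* :e₃ (x :- (a :+ b :+ c :+ d)) (x :- (b :+ c :+ e)) (x :- (a :+ d :+ e))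
                   (:- (b :- c)) (:- (a :- d)) (:- (:- e)))
    refl a b c d e x

  -- Both cubics are monic, so their difference is a quadratic whose coefficients are the
  -- differences of the elementary symmetric functions; the outer factor x belongs to the eigenvalue
  -- 0. The subtracted product has the shape to which `product` unfolds in `IsSpectrum`. The
  -- identity serves both directions between spectrum and coefficients.
  spectral-defect : ∀ p q r u v w l m x →
    x * ((l + l + m - e₁ p q r) * (x * x)
         + (e₂ p q r u v w - (l * l + 2# * (l * m))) * x
         + (l * l * m - e₃ p q r u v w))
      ≈ x * e₃ (x - p) (x - q) (x - r) (- u) (- v) (- w)
        - (x - 0#) * ((x - l) * ((x - l) * ((x - m) * 1#)))
  spectral-defect = solve 9 (λ p q r u v w l m x →
    x :* ((l :+ l :+ m :- (p :+ q :+ r)) :* (x :* x)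
          :+ (:e₂ p q r u v w :- (l :* l :+ :2 :* (l :* m))) :* x
          :+ (l :* l :* m :- :e₃ p q r u v w))
    := x :* :e₃ (x :- p) (x :- q) (x :- r) (:- u) (:- v) (:- w)
       :- (x :- :0) :* ((x :- l) :* ((x :- l) :* ((x :- m) :* :1))))
    refl

  -- In terms of the eigenvalues: (xy)² + (xz)² + (yz)² = (xy + xz + yz)² - 2 (x + y + z) xyz.
  minor-squares : ∀ p q r u v w →
    (p * q - u * u) * (p * q - u * u)
    + ((p * r - v * v) * (p * r - v * v)
    + ((q * r - w * w) * (q * r - w * w)
    + 2# * ((p * w - u * v) * (p * w - u * v)
    + ((u * w - q * v) * (u * w - q * v) + (u * r - v * w) * (u * r - v * w)))))
      ≈ e₂ p q r u v w * e₂ p q r u v w - 2# * e₁ p q r * e₃ p q r u v w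
  minor-squares = solve 6 (λ p q r u v w →
    (p :* q :- u :* u) :* (p :* q :- u :* u)
    :+ ((p :* r :- v :* v) :* (p :* r :- v :* v)
    :+ ((q :* r :- w :* w) :* (q :* r :- w :* w)
    :+ :2 :* ((p :* w :- u :* v) :* (p :* w :- u :* v)
    :+ ((u :* w :- q :* v) :* (u :* w :- q :* v) :+ (u :* r :- v :* w) :* (u :* r :- v :* w)))))
    := :e₂ p q r u v w :* :e₂ p q r u v w :- :2 :* (p :+ q :+ r) :* :e₃ p q r u v w)
    refl

  -- The three coefficients are integer combinations of the values at 1, -1 and 2.
  quadratic-zero : ∀ A B C → (∀ x → x * (A * (x * x) + B * x + C) ≈ 0#) →
                   A ≈ 0# × B ≈ 0# × C ≈ 0#
  quadratic-zero A B C vanishes = A≈0 , B≈0 , C≈0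
    where
    0<6 : 0# < 6#
    0<6 = 0<-resp (solve 0 (:2 :+ (:2 :+ :2) := :6) refl)
      (+-pos 0<2 (+-pos 0<2 0<2))

    combination : ∀ i j k → ⟦ i ⟧ᶻ * 0# + ⟦ j ⟧ᶻ * 0# + ⟦ k ⟧ᶻ * 0# ≈ 0#
    combination i j k = trans (+-cong (+-cong (zeroʳ _) (zeroʳ _)) (zeroʳ _))
      (trans (+-congʳ (+-identityʳ 0#)) (+-identityʳ 0#))

    P : Carrier → Carrier
    P x = x * (A * (x * x) + B * x + C)

    values : ∀ i j k → ⟦ i ⟧ᶻ * P 1# + ⟦ j ⟧ᶻ * P (- 1#) + ⟦ k ⟧ᶻ * P 2# ≈ 0#
    values i j k = trans
      (+-cong (+-cong (*-congˡ (vanishes 1#)) (*-congˡ (vanishes (- 1#)))) (*-congˡ (vanishes 2#)))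
      (combination i j k)

    :P : ∀ {n} → (A B C x : Polynomial n) → Polynomial n
    :P A B C x = x :* (A :* (x :* x) :+ B :* x :+ C)

    :values : ∀ {n} → (i j k : ℤ) (A B C : Polynomial n) → Polynomial n
    :values i j k A B C =
      con i :* :P A B C (:1) :+ con j :* :P A B C (:- :1)
      :+ con k :* :P A B C (:2)

    A≈0 = *-cancel-zero 0<6 (trans
      (solve 3 (λ A B C → :6 :* A := :values -[1+ 2 ] -[1+ 0 ] (+ 1) A B C) refl A B C)
      (values -[1+ 2 ] -[1+ 0 ] (+ 1)))
    B≈0 = *-cancel-zero 0<2 (trans
      (solve 3 (λ A B C → :2 :* B := :values (+ 1) (+ 1) (+ 0) A B C) refl A B C)
      (values (+ 1) (+ 1) (+ 0)))
    C≈0 = *-cancel-zero 0<6 (trans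
      (solve 3 (λ A B C → :6 :* C := :values (+ 6) -[1+ 1 ] -[1+ 0 ] A B C) refl A B C)
      (values (+ 6) -[1+ 1 ] -[1+ 0 ]))

  -- Vanishing minors at a double eigenvalue.

  -- By `minor-squares` a sum of nonnegative multiples of squares equals e₂² - 2 e₁ e₃, which is
  -- zero here, so each square vanishes.
  minors-vanish : ∀ {p q r u v w} → e₂ p q r u v w ≈ 0# → e₃ p q r u v w ≈ 0# →
                  p * q ≈ u * u × q * r ≈ w * w
  minors-vanish {p} {q} {r} {u} {v} {w} e₂≈0 e₃≈0 =
      minor (nonneg-sum≈0 (square-nonneg _) 0≤s₂ total)
    -- The minor of the indices 2, 3 is the third summand, so two squares are split off first.
    , minor (nonneg-sum≈0 (square-nonneg _) 0≤s₄
        (rest (square-nonneg _) 0≤s₃ (rest (square-nonneg _) 0≤s₂ total)))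
    where
    minor : ∀ {x y} → (x - y) * (x - y) ≈ 0# → x ≈ y
    minor {x} {y} sq = x-y≈0⇒x≈y x y (square≈0⇒≈0 sq)

    rest : ∀ {x y} → 0# ≤ x → 0# ≤ y → x + y ≈ 0# → y ≈ 0#
    rest 0≤x 0≤y x+y≈0 = nonneg-sum≈0 0≤y 0≤x (trans (+-comm _ _) x+y≈0)

    0≤s₄ = *-nonneg (inj₁ 0<2) (+-nonneg (square-nonneg (p * w - u * v))
      (+-nonneg (square-nonneg (u * w - q * v)) (square-nonneg (u * r - v * w))))
    0≤s₃ = +-nonneg (square-nonneg (q * r - w * w)) 0≤s₄
    0≤s₂ = +-nonneg (square-nonneg (p * r - v * v)) 0≤s₃

    total = begin
      _
        ≈⟨ minor-squares p q r u v w ⟩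
      e₂ p q r u v w * e₂ p q r u v w - 2# * e₁ p q r * e₃ p q r u v w
        ≈⟨ +-cong (*-cong e₂≈0 e₂≈0) (-‿cong (*-congˡ e₃≈0)) ⟩
      0# * 0# - 2# * e₁ p q r * 0#
        ≈⟨ solve 1 (λ t → :0 :* :0 :- :2 :* t :* :0 := :0)
             refl (e₁ p q r) ⟩
      0# ∎

  -- With χ(x) = x³ - e₁ x² + e₂ x - e₃, the characteristic polynomial before the shift, the right
  -- side is the derivative χ'(l).
  shifted-e₂ : ∀ p q r u v w l →
    e₂ (p - l) (q - l) (r - l) u v w ≈
      e₂ p q r u v w - 2# * l * e₁ p q r + 3# * (l * l)
  shifted-e₂ = solve 7 (λ p q r u v w l →
    :e₂ (p :- l) (q :- l) (r :- l) u v w :=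
      :e₂ p q r u v w :- :2 :* l :* (p :+ q :+ r) :+ :3 :* (l :* l)) refl

  -- The right side is - χ(l).
  shifted-e₃ : ∀ p q r u v w l →
    e₃ (p - l) (q - l) (r - l) u v w ≈
      e₃ p q r u v w - l * e₂ p q r u v w + l * l * e₁ p q r - l * l * l
  shifted-e₃ = solve 7 (λ p q r u v w l →
    :e₃ (p :- l) (q :- l) (r :- l) u v w :=
      :e₃ p q r u v w :- l :* :e₂ p q r u v w :+ l :* l :* (p :+ q :+ r) :- l :* l :* l) refl

  -- The matrix with diagonal (p, q, r) and entries u, v, w has the eigenvalues l, l, m.
  record HasCoefficients (p q r u v w l m : Carrier) : Set ℓ₁ where
    field
      e₁≈ : e₁ p q r ≈ l + l + m
      e₂≈ : e₂ p q r u v w ≈ l * l + 2# * (l * m)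
      e₃≈ : e₃ p q r u v w ≈ l * l * m

    -- As χ(x) = (x - l)² (x - m), both χ and χ' vanish at l, which are the two hypotheses of
    -- `minors-vanish` for the shifted matrix.
    shifted-minors-vanish :
      (p - l) * (q - l) ≈ u * u × (q - l) * (r - l) ≈ w * w
    shifted-minors-vanish = minors-vanish
      (begin
        e₂ (p - l) (q - l) (r - l) u v w
          ≈⟨ shifted-e₂ p q r u v w l ⟩
        e₂ p q r u v w - 2# * l * e₁ p q r + 3# * (l * l)
          ≈⟨ +-congʳ (+-cong e₂≈ (-‿cong (*-congˡ e₁≈))) ⟩
        l * l + 2# * (l * m) - 2# * l * (l + l + m) + 3# * (l * l)
          ≈⟨ solve 2 (λ l m → l :* l :+ :2 :* (l :* m) :- :2 :* l :* (l :+ l :+ m)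
               :+ :3 :* (l :* l) := :0) refl l m ⟩
        0# ∎)
      (begin
        e₃ (p - l) (q - l) (r - l) u v w
          ≈⟨ shifted-e₃ p q r u v w l ⟩
        e₃ p q r u v w - l * e₂ p q r u v w + l * l * e₁ p q r - l * l * l
          ≈⟨ +-congʳ (+-cong (+-cong e₃≈ (-‿cong (*-congˡ e₂≈))) (*-congˡ e₁≈)) ⟩
        l * l * m - l * (l * l + 2# * (l * m)) + l * l * (l + l + m) - l * l * l
          ≈⟨ solve 2 (λ l m → l :* l :* m :- l :* (l :* l :+ :2 :* (l :* m))
               :+ l :* l :* (l :+ l :+ m) :- l :* l :* l := :0) refl l m ⟩
        0# ∎)

  -- Necessity of the bounds.

  -- The difference (x + y)² - (2 z)² equals (x - y)². Only x + y has to be positive to take roots,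
  -- so the sign of z is free.
  am-gm : ∀ {x y z} → 0# < x → 0# < y → x * y ≈ z * z → 2# * z ≤ x + y
  am-gm {x} {y} {z} 0<x 0<y xy≈z² = square-cancel-≤ (+-pos 0<x 0<y) (0≤y-x⇒x≤y (0≤-resp (begin
    (x - y) * (x - y)
      ≈⟨ solve 2 (λ x y → (x :- y) :* (x :- y) := (x :+ y) :* (x :+ y) :- :4 :* (x :* y))
           refl x y ⟩
    (x + y) * (x + y) - 4# * (x * y)
      ≈⟨ +-congˡ (-‿cong (*-congˡ xy≈z²)) ⟩
    (x + y) * (x + y) - 4# * (z * z)
      ≈⟨ solve 3 (λ x y z → (x :+ y) :* (x :+ y) :- :4 :* (z :* z) :=
           (x :+ y) :* (x :+ y) :- :2 :* z :* (:2 :* z)) refl x y z ⟩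
    (x + y) * (x + y) - 2# * z * (2# * z) ∎)
    (square-nonneg (x - y))))

  ≤-half : ∀ {x y} → 2# * x ≤ y → x ≤ 2# ⁻¹ * y
  ≤-half {x} {y} 2x≤y = 0≤y-x⇒x≤y (*-cancel-nonneg 0<2 (0≤-resp (begin
    y - 2# * x                  ≈⟨ +-congʳ (proj₂ (quotient 0<2 y)) ⟨
    2# * (2# ⁻¹ * y) - 2# * x   ≈⟨ solve 2 (λ z x → :2 :* z :- :2 :* x :=
                                     :2 :* (z :- x)) refl (2# ⁻¹ * y) x ⟩
    2# * (2# ⁻¹ * y - x)        ∎)
    (x≤y⇒0≤y-x 2x≤y)))

  half-≤ : ∀ {x y} → x ≤ 2# ⁻¹ * y → 2# * x ≤ y
  half-≤ {x} {y} x≤y/2 = 0≤y-x⇒x≤y (0≤-resp (begin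
    2# * (2# ⁻¹ * y - x)        ≈⟨ solve 2 (λ z x → :2 :* (z :- x) :=
                                     :2 :* z :- :2 :* x) refl (2# ⁻¹ * y) x ⟩
    2# * (2# ⁻¹ * y) - 2# * x   ≈⟨ +-congʳ (proj₂ (quotient 0<2 y)) ⟩
    y - 2# * x                  ∎)
    (*-nonneg (inj₁ 0<2) (x≤y⇒0≤y-x x≤y/2)))

  WeightCoefficients : (a b c d e l m : Carrier) → Set ℓ₁
  WeightCoefficients a b c d e =
    HasCoefficients (a + b + c + d) (b + c + e) (a + d + e) (b - c) (a - d) (- e)

  -- Kirchhoff's theorem: the sum runs over the eight spanning trees.
  matrix-tree : ∀ a b c d e →
    e₃ (a + b + c + d) (b + c + e) (a + d + e) (b - c) (a - d) (- e) ≈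
      4# * (e * (a + b) * (c + d) + a * b * (c + d) + c * d * (a + b))
  matrix-tree = solve 5 (λ a b c d e → :w₃ a b c d e :=
    :4 :* (e :* (a :+ b) :* (c :+ d) :+ a :* b :* (c :+ d) :+ c :* d :* (a :+ b))) refl

  -- α, β, γ are the diagonal entries of the compressed Laplacian minus l.
  module _ {α β γ u e l m : Carrier} (0<e : 0# < e)
           (β+γ≈ : β + γ ≈ α + 2# * e - l) (α+β+γ≈ : α + β + γ ≈ m - l)
           (αβ≈u² : α * β ≈ u * u) (βγ≈e² : β * γ ≈ e * e) where

    private
      0<βγ : 0# < β * γ
      0<βγ = 0<-resp (sym βγ≈e²) (*-pos 0<e 0<e)

    -- Eliminating α from the two linear relations gives m - 2 l = 2 e + 2 (β + γ - 2 e). The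
    -- bracket is nonnegative by `am-gm`, and e > 0 makes the inequality strict.
    pos⇒large : 0# < β → 2# * l < m
    pos⇒large 0<β = 0<y-x⇒x<y (0<-resp (begin
      2# * e + 2# * (β + γ - 2# * e)
        ≈⟨ solve 3 (λ β γ e → :2 :* e :+ :2 :* (β :+ γ :- :2 :* e) :=
             β :+ γ :+ (β :+ γ) :- :2 :* e) refl β γ e ⟩
      β + γ + (β + γ) - 2# * e
        ≈⟨ +-congʳ (+-congˡ β+γ≈) ⟩
      β + γ + (α + 2# * e - l) - 2# * e
        ≈⟨ solve 5 (λ α β γ e l → β :+ γ :+ (α :+ :2 :* e :- l) :- :2 :* e :=
             α :+ β :+ γ :- l) refl α β γ e l ⟩
      α + β + γ - l
        ≈⟨ +-congʳ α+β+γ≈ ⟩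
      m - l - l
        ≈⟨ solve 2 (λ l m → m :- l :- l := m :- :2 :* l) refl l m ⟩
      m - 2# * l ∎)
      (+-pos-nonneg (*-pos 0<2 0<e)
        (*-nonneg (inj₁ 0<2) (x≤y⇒0≤y-x (am-gm 0<β (*-cancel-pos 0<β 0<βγ) βγ≈e²)))))

    -- The linear relations give l - 2 m = (- β - γ - 2 e) - 3 α. The bracket is nonnegative by
    -- `am-gm` for - β and - γ, while α β = u² ≥ 0 with β < 0 forces α ≤ 0.
    neg⇒small : β < 0# → 2# * m ≤ l
    neg⇒small β<0 = 0≤y-x⇒x≤y (0≤-resp (begin
      - β + - γ - 2# * e + 3# * - α
        ≈⟨ solve 5 (λ α β γ e l → :- β :+ :- γ :- :2 :* e :+ :3 :* :- α :=
             β :+ γ :- (α :+ :2 :* e :- l) :- :2 :* (α :+ β :+ γ) :- l)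
             refl α β γ e l ⟩
      β + γ - (α + 2# * e - l) - 2# * (α + β + γ) - l
        ≈⟨ +-congʳ (+-cong (+-congʳ β+γ≈) (-‿cong (*-congˡ α+β+γ≈))) ⟩
      α + 2# * e - l - (α + 2# * e - l) - 2# * (m - l) - l
        ≈⟨ solve 3 (λ t l m → t :- t :- :2 :* (m :- l) :- l := l :- :2 :* m)
             refl (α + 2# * e - l) l m ⟩
      l - 2# * m ∎)
      (+-nonneg (x≤y⇒0≤y-x (am-gm 0<-β 0<-γ (trans (-x*-y≈x*y β γ) βγ≈e²)))
        (*-nonneg (inj₁ (+-pos 0<2 0<1)) 0≤-α)))
      where
      -x*-y≈x*y : ∀ x y → - x * - y ≈ x * y
      -x*-y≈x*y = solve 2 (λ x y → :- x :* :- y := x :* y) refl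

      0<-β = neg⇒0<- β<0
      0<-γ = *-cancel-pos 0<-β (0<-resp (sym (-x*-y≈x*y β γ)) 0<βγ)
      0≤-α = *-cancel-nonneg 0<-β
        (0≤-resp (sym (trans (-x*-y≈x*y β α) (trans (*-comm β α) αβ≈u²))) (square-nonneg u))

    large⊎small : 2# * l < m ⊎ 2# * m ≤ l
    large⊎small with compare 0# β
    ... | tri< 0<β _ _ = inj₁ (pos⇒large 0<β)
    ... | tri> _ _ β<0 = inj₂ (neg⇒small β<0)
    ... | tri≈ _ 0≈β _ = contradiction 0<βγ (irrefl (trans (sym (zeroˡ γ)) (*-congʳ 0≈β)))

  weights⇒bounds : ∀ {a b c d e l m} → 0# < a → 0# < b → 0# < c → 0# < d → 0# < e → 0# < l →
    WeightCoefficients a b c d e l m → 2# * l < m ⊎ (0# < m × m ≤ 2# ⁻¹ * l)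
  weights⇒bounds {a} {b} {c} {d} {e} {l} {m} 0<a 0<b 0<c 0<d 0<e 0<l coefficients =
    map₂ (λ 2m≤l → 0<m , ≤-half 2m≤l)
      (large⊎small 0<e β+γ≈ α+β+γ≈ (proj₁ shifted-minors-vanish)
        (trans (proj₂ shifted-minors-vanish)
          (solve 1 (λ e → :- e :* :- e := e :* e) refl e)))
    where
    open HasCoefficients coefficients

    β+γ≈ : b + c + e - l + (a + d + e - l) ≈ a + b + c + d - l + 2# * e - l
    β+γ≈ = solve 6 (λ a b c d e l → b :+ c :+ e :- l :+ (a :+ d :+ e :- l) :=
      a :+ b :+ c :+ d :- l :+ :2 :* e :- l) refl a b c d e l

    α+β+γ≈ : a + b + c + d - l + (b + c + e - l) + (a + d + e - l) ≈ m - l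
    α+β+γ≈ = begin
      a + b + c + d - l + (b + c + e - l) + (a + d + e - l)
        ≈⟨ solve 4 (λ p q r l → p :- l :+ (q :- l) :+ (r :- l) := p :+ q :+ r :- :3 :* l)
             refl (a + b + c + d) (b + c + e) (a + d + e) l ⟩
      e₁ (a + b + c + d) (b + c + e) (a + d + e) - 3# * l
        ≈⟨ +-congʳ e₁≈ ⟩
      l + l + m - 3# * l
        ≈⟨ solve 2 (λ l m → l :+ l :+ m :- :3 :* l := m :- l) refl l m ⟩
      m - l ∎

    -- The product l² m equals the spanning tree sum, all of whose terms are positive.
    0<m : 0# < m
    0<m = *-cancel-pos (*-pos 0<l 0<l) (0<-resp (trans (sym (matrix-tree a b c d e)) e₃≈)
      (*-pos 0<4 (+-pos (+-pos
        (*-pos (*-pos 0<e (+-pos 0<a 0<b)) (+-pos 0<c 0<d))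
        (*-pos (*-pos 0<a 0<b) (+-pos 0<c 0<d)))
        (*-pos (*-pos 0<c 0<d) (+-pos 0<a 0<b)))))

  -- Matrices of the graph and their edge weights.

  open RawSemiringDefinitions (Semiring.rawSemiring semiring) using (_^_)
  open MonoidSum +-monoid using (sum; sum-cong-≋)

  det-cong : ∀ {n} {M N : Matrix ℝ n} → (∀ i j → M i j ≈ N i j) → det ℝ M ≈ det ℝ N
  det-cong {zero}  M≈N = refl
  det-cong {suc n} M≈N = sum-cong-≋ λ j →
    *-cong (*-congˡ {(- 1#) ^ Fin.toℕ j} (M≈N zero j)) (det-cong λ i k → M≈N (suc i) (punchIn j k))

  charPoly-cong : ∀ {n} {A B : Matrix ℝ n} → (∀ i j → A i j ≈ B i j) →
                  ∀ x → charPoly ℝ A x ≈ charPoly ℝ B x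
  charPoly-cong A≈B x = det-cong λ i j → +-congˡ (-‿cong (A≈B i j))

  -- Definitionally the summand in the field `diagonal` of `𝒮ᴸ`, named so that two such sums can be
  -- compared.
  offDiagonal : ∀ {n} → Matrix ℝ n → Fin n → Fin n → Carrier
  offDiagonal A i k = if does (k ≟ i) then 0# else A i k

  laplacian-diagonal : ∀ a b c d e i →
    laplacian a b c d e i i ≈ - sum (offDiagonal (laplacian a b c d e) i)
  laplacian-diagonal a b c d e 0F = solve 2 (λ a b →
    a :+ b := :- (:0 :+ (:0 :+ (:- a :+ (:- b :+ :0))))) refl a b
  laplacian-diagonal a b c d e 1F = solve 2 (λ c d →
    c :+ d := :- (:0 :+ (:0 :+ (:- c :+ (:- d :+ :0))))) refl c d
  laplacian-diagonal a b c d e 2F = solve 3 (λ a c e →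
    a :+ c :+ e := :- (:- a :+ (:- c :+ (:0 :+ (:- e :+ :0))))) refl a c e
  laplacian-diagonal a b c d e 3F = solve 3 (λ b d e →
    b :+ d :+ e := :- (:- b :+ (:- d :+ (:- e :+ (:0 :+ :0))))) refl b d e

  laplacian-symmetric : ∀ a b c d e i j → laplacian a b c d e i j ≈ laplacian a b c d e j i
  laplacian-symmetric a b c d e 0F 0F = refl
  laplacian-symmetric a b c d e 0F 1F = refl
  laplacian-symmetric a b c d e 0F 2F = refl
  laplacian-symmetric a b c d e 0F 3F = refl
  laplacian-symmetric a b c d e 1F 0F = refl
  laplacian-symmetric a b c d e 1F 1F = refl
  laplacian-symmetric a b c d e 1F 2F = refl
  laplacian-symmetric a b c d e 1F 3F = refl
  laplacian-symmetric a b c d e 2F 0F = refl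
  laplacian-symmetric a b c d e 2F 1F = refl
  laplacian-symmetric a b c d e 2F 2F = refl
  laplacian-symmetric a b c d e 2F 3F = refl
  laplacian-symmetric a b c d e 3F 0F = refl
  laplacian-symmetric a b c d e 3F 1F = refl
  laplacian-symmetric a b c d e 3F 2F = refl
  laplacian-symmetric a b c d e 3F 3F = refl

  -- Every matrix of the class is the Laplacian of its own positive edge weights: symmetry fixes the
  -- lower triangle, and the zero row sums fix the diagonal.
  module Weights {A : Matrix ℝ 4} (A∈𝒮ᴸ : 𝒮ᴸ ℝ K₄-e A) where
    open 𝒮ᴸ A∈𝒮ᴸ
    open SimpleGraph K₄-e using (adj?)

    a b c d e : Carrier
    a = - A 0F 2F
    b = - A 0F 3F
    c = - A 1F 2F
    d = - A 1F 3F
    e = - A 2F 3F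

    0<a : 0# < a
    0<a = neg⇒0<- (edge (from-yes (adj? 0F 2F)))
    0<b : 0# < b
    0<b = neg⇒0<- (edge (from-yes (adj? 0F 3F)))
    0<c : 0# < c
    0<c = neg⇒0<- (edge (from-yes (adj? 1F 2F)))
    0<d : 0# < d
    0<d = neg⇒0<- (edge (from-yes (adj? 1F 3F)))
    0<e : 0# < e
    0<e = neg⇒0<- (edge (from-yes (adj? 2F 3F)))

    L : Matrix ℝ 4
    L = laplacian a b c d e

    private
      upper : ∀ i j → i Fin.< j → A i j ≈ L i j
      upper 0F 1F _ = nonEdge (λ ()) (from-no (adj? 0F 1F))
      upper 0F 2F _ = sym (-‿involutive _)
      upper 0F 3F _ = sym (-‿involutive _)
      upper 1F 2F _ = sym (-‿involutive _)
      upper 1F 3F _ = sym (-‿involutive _)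
      upper 2F 3F _ = sym (-‿involutive _)
      upper _ 0F ()
      upper 1F 1F (ℕ.s≤s ())
      upper 2F 1F (ℕ.s≤s ())
      upper 3F 1F (ℕ.s≤s ())
      upper 2F 2F (ℕ.s≤s (ℕ.s≤s ()))
      upper 3F 2F (ℕ.s≤s (ℕ.s≤s ()))
      upper 3F 3F (ℕ.s≤s (ℕ.s≤s (ℕ.s≤s ())))

      -- The diagonal position is masked by zero on both sides, so this needs no knowledge of the
      -- diagonal and can be used to determine it.
      offDiagonal≈ : ∀ i k → offDiagonal A i k ≈ offDiagonal L i k
      offDiagonal≈ i k with k ≟ i | Finₚ.<-cmp i k
      ... | yes _   | _ = refl
      ... | no _    | tri< i<k _ _ = upper i k i<k
      ... | no k≢i  | tri≈ _ i≡k _ = contradiction (≡.sym i≡k) k≢i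
      ... | no _    | tri> _ _ k<i =
        trans (symmetric i k) (trans (upper k i k<i) (laplacian-symmetric a b c d e k i))

    A≈L : ∀ i j → A i j ≈ L i j
    A≈L i j with Finₚ.<-cmp i j
    ... | tri< i<j _ _ = upper i j i<j
    ... | tri≈ _ ≡.refl _ = begin
      A i i                      ≈⟨ diagonal i ⟩
      - sum (offDiagonal A i)    ≈⟨ -‿cong (sum-cong-≋ (offDiagonal≈ i)) ⟩
      - sum (offDiagonal L i)    ≈⟨ laplacian-diagonal a b c d e i ⟨
      L i i                      ∎
    ... | tri> _ _ j<i = trans (symmetric i j)
      (trans (upper j i j<i) (laplacian-symmetric a b c d e j i))

  -- The spectrum condition makes the right side of `spectral-defect` vanish for every x, and
  -- `quadratic-zero` then equates the coefficients.
  spectrum⇒coefficients : ∀ {a b c d e l m} →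
    IsSpectrum ℝ (laplacian a b c d e) (0# ∷ l ∷ l ∷ m ∷ []) → WeightCoefficients a b c d e l m
  spectrum⇒coefficients {a} {b} {c} {d} {e} {l} {m} spectrum = record
    { e₁≈ = sym (x-y≈0⇒x≈y _ _ (proj₁ zeros))
    ; e₂≈ = x-y≈0⇒x≈y _ _ (proj₁ (proj₂ zeros))
    ; e₃≈ = sym (x-y≈0⇒x≈y _ _ (proj₂ (proj₂ zeros)))
    }
    where
    zeros = quadratic-zero _ _ _ λ x → trans
      (spectral-defect (a + b + c + d) (b + c + e) (a + d + e) (b - c) (a - d) (- e) l m x)
      (trans (+-congʳ (trans (sym (charPoly-laplacian a b c d e x)) (spectrum x))) (-‿inverseʳ _))

  coefficients⇒spectrum : ∀ {a b c d e l m} →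
    WeightCoefficients a b c d e l m → IsSpectrum ℝ (laplacian a b c d e) (0# ∷ l ∷ l ∷ m ∷ [])
  coefficients⇒spectrum {a} {b} {c} {d} {e} {l} {m} coefficients x =
    trans (charPoly-laplacian a b c d e x) (x-y≈0⇒x≈y _ _ (trans
      (sym (spectral-defect (a + b + c + d) (b + c + e) (a + d + e) (b - c) (a - d) (- e) l m x))
      (trans (*-congˡ (+-cong (+-cong (*-congʳ (difference (sym e₁≈))) (*-congʳ (difference e₂≈)))
          (difference (sym e₃≈))))
        (solve 1 (λ x → x :* (:0 :* (x :* x) :+ :0 :* x :+ :0) := :0)
          refl x))))
    where
    open HasCoefficients coefficients
    difference : ∀ {x y} → x ≈ y → x - y ≈ 0#
    difference x≈y = trans (+-congʳ x≈y) (-‿inverseʳ _)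

  laplacian∈𝒮ᴸ : ∀ {a b c d e} → 0# < a → 0# < b → 0# < c → 0# < d → 0# < e →
                 𝒮ᴸ ℝ K₄-e (laplacian a b c d e)
  laplacian∈𝒮ᴸ {a} {b} {c} {d} {e} 0<a 0<b 0<c 0<d 0<e = record
    { symmetric = laplacian-symmetric a b c d e
    ; edge      = edge _ _
    ; nonEdge   = nonEdge _ _
    ; diagonal  = laplacian-diagonal a b c d e
    }
    where
    open SimpleGraph K₄-e using (Adj; adj?)

    neg : ∀ {x} → 0# < x → - x < 0#
    neg {x} 0<x = 0<y-x⇒x<y (0<-resp (solve 1 (λ x → x := :0 :- :- x) refl x) 0<x)

    edge : ∀ i j → Adj i j → laplacian a b c d e i j < 0#
    edge 0F 0F ij = contradiction ij (from-no (adj? 0F 0F))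
    edge 0F 1F ij = contradiction ij (from-no (adj? 0F 1F))
    edge 0F 2F _  = neg 0<a
    edge 0F 3F _  = neg 0<b
    edge 1F 0F ij = contradiction ij (from-no (adj? 1F 0F))
    edge 1F 1F ij = contradiction ij (from-no (adj? 1F 1F))
    edge 1F 2F _  = neg 0<c
    edge 1F 3F _  = neg 0<d
    edge 2F 0F _  = neg 0<a
    edge 2F 1F _  = neg 0<c
    edge 2F 2F ij = contradiction ij (from-no (adj? 2F 2F))
    edge 2F 3F _  = neg 0<e
    edge 3F 0F _  = neg 0<b
    edge 3F 1F _  = neg 0<d
    edge 3F 2F _  = neg 0<e
    edge 3F 3F ij = contradiction ij (from-no (adj? 3F 3F))

    nonEdge : ∀ i j → i ≢ j → ¬ Adj i j → laplacian a b c d e i j ≈ 0#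
    nonEdge 0F 0F i≢i _ = contradiction ≡.refl i≢i
    nonEdge 0F 1F _ _   = refl
    nonEdge 0F 2F _ ¬ij = contradiction (from-yes (adj? 0F 2F)) ¬ij
    nonEdge 0F 3F _ ¬ij = contradiction (from-yes (adj? 0F 3F)) ¬ij
    nonEdge 1F 0F _ _   = refl
    nonEdge 1F 1F i≢i _ = contradiction ≡.refl i≢i
    nonEdge 1F 2F _ ¬ij = contradiction (from-yes (adj? 1F 2F)) ¬ij
    nonEdge 1F 3F _ ¬ij = contradiction (from-yes (adj? 1F 3F)) ¬ij
    nonEdge 2F 0F _ ¬ij = contradiction (from-yes (adj? 2F 0F)) ¬ij
    nonEdge 2F 1F _ ¬ij = contradiction (from-yes (adj? 2F 1F)) ¬ij
    nonEdge 2F 2F i≢i _ = contradiction ≡.refl i≢i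
    nonEdge 2F 3F _ ¬ij = contradiction (from-yes (adj? 2F 3F)) ¬ij
    nonEdge 3F 0F _ ¬ij = contradiction (from-yes (adj? 3F 0F)) ¬ij
    nonEdge 3F 1F _ ¬ij = contradiction (from-yes (adj? 3F 1F)) ¬ij
    nonEdge 3F 2F _ ¬ij = contradiction (from-yes (adj? 3F 2F)) ¬ij
    nonEdge 3F 3F i≢i _ = contradiction ≡.refl i≢i

  realizable⇒bounds : ∀ {l m} → 0# < l →
    LaplacianRealizable ℝ K₄-e (0# ∷ l ∷ l ∷ m ∷ []) → 2# * l < m ⊎ (0# < m × m ≤ 2# ⁻¹ * l)
  realizable⇒bounds 0<l (A , A∈𝒮ᴸ , spectrum) = weights⇒bounds 0<a 0<b 0<c 0<d 0<e 0<l
    (spectrum⇒coefficients λ x → trans (sym (charPoly-cong A≈L x)) (spectrum x))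
    where open Weights A∈𝒮ᴸ

  -- Explicit realizations.

  weights⇒realizable : ∀ {a b c d e l m} →
    0# < a → 0# < b → 0# < c → 0# < d → 0# < e → WeightCoefficients a b c d e l m →
    LaplacianRealizable ℝ K₄-e (0# ∷ l ∷ l ∷ m ∷ [])
  weights⇒realizable {a} {b} {c} {d} {e} 0<a 0<b 0<c 0<d 0<e coefficients =
    laplacian a b c d e , laplacian∈𝒮ᴸ 0<a 0<b 0<c 0<d 0<e , coefficients⇒spectrum coefficients

  HasCoefficients-cong : ∀ {p q r u v w l l′ m m′} → l ≈ l′ → m ≈ m′ →
    HasCoefficients p q r u v w l m → HasCoefficients p q r u v w l′ m′
  HasCoefficients-cong l≈l′ m≈m′ coefficients = record
    { e₁≈ = trans e₁≈ (+-cong (+-cong l≈l′ l≈l′) m≈m′)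
    ; e₂≈ = trans e₂≈ (+-cong (*-cong l≈l′ l≈l′) (*-congˡ (*-cong l≈l′ m≈m′)))
    ; e₃≈ = trans e₃≈ (*-cong (*-cong l≈l′ l≈l′) m≈m′)
    }
    where open HasCoefficients coefficients

  -- For identities that hold only modulo the equation of a square root: the solver checks them with
  -- an explicit cofactor k, and the equation removes the multiple of k.
  modulo : ∀ {x t k y z} → y ≈ z → x ≈ t + k * (z - y) → x ≈ t
  modulo {x} {t} {k} {y} {z} y≈z x≈t+k[z-y] = begin
    x                ≈⟨ x≈t+k[z-y] ⟩
    t + k * (z - y)  ≈⟨ +-congˡ (*-congˡ (+-congˡ (-‿cong y≈z))) ⟩
    t + k * (z - z)  ≈⟨ solve 3 (λ t k z → t :+ k :* (z :- z) := t) refl t k z ⟩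
    t                ∎

  -- Multiplication by the conjugate x + r, which is positive, turns the claim into x² - y > 0.
  x-√y-pos : ∀ {x r y} → 0# < x → 0# ≤ r → r * r ≈ y → 0# < x * x - y → 0# < x - r
  x-√y-pos {x} {r} {y} 0<x 0≤r r²≈y 0<x²-y = *-cancel-pos (+-pos-nonneg 0<x 0≤r) (0<-resp (begin
    x * x - y          ≈⟨ +-congˡ (-‿cong r²≈y) ⟨
    x * x - r * r      ≈⟨ solve 2 (λ x r → x :* x :- r :* r := (x :+ r) :* (x :- r)) refl x r ⟩
    (x + r) * (x - r)  ∎)
    0<x²-y)

  -- Each of the three families of weights below comes from a vector v ⟂ (1,1,1,1) such that
  -- A - l (I - J/4) = ± v vᵀ, where l = 4 q and J is the all-ones matrix. Up to sign and order,
  -- v is (√q, -√q, y, -y), (√q, √q, y - √q, - y - √q) or (s, q/s, - s - q/s, 0).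
  small⇒realizable : ∀ {q m l μ} → 4# * q ≈ l → 2# * m ≈ μ → 0# < q → 0# < m → m ≤ q →
    LaplacianRealizable ℝ K₄-e (0# ∷ l ∷ l ∷ μ ∷ [])
  small⇒realizable {q} {m} 4q≈l 2m≈μ 0<q 0<m m≤q =
    let z , 0≤z , z²≈q[q-m] = sqrt (*-nonneg (inj₁ 0<q) (x≤y⇒0≤y-x m≤q))
        0<q+z = +-pos-nonneg 0<q 0≤z
        -- Since z² = q (q - m), the difference q² - z² is q m.
        0<q-z = x-√y-pos 0<q 0≤z z²≈q[q-m]
          (0<-resp (solve 2 (λ q m → q :* m := q :* q :- q :* (q :- m)) refl q m) (*-pos 0<q 0<m))
    in weights⇒realizable 0<q+z 0<q-z 0<q-z 0<q+z 0<m
         (HasCoefficients-cong 4q≈l 2m≈μ (coefficients z z²≈q[q-m]))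
    where
    coefficients : ∀ z → z * z ≈ q * (q - m) →
      WeightCoefficients (q + z) (q - z) (q - z) (q + z) m (4# * q) (2# * m)
    coefficients z z²≈ = record
      { e₁≈ = solve 3 (λ q m z →
          :w₁ (q :+ z) (q :- z) (q :- z) (q :+ z) m := :σ₁ (:4 :* q) (:2 :* m))
          refl q m z
      ; e₂≈ = modulo z²≈ (solve 3 (λ q m z →
          :w₂ (q :+ z) (q :- z) (q :- z) (q :+ z) m :=
            :σ₂ (:4 :* q) (:2 :* m) :+ :4 :* (q :* (q :- m) :- z :* z))
          refl q m z)
      ; e₃≈ = modulo z²≈ (solve 3 (λ q m z →
          :w₃ (q :+ z) (q :- z) (q :- z) (q :+ z) m :=
            :σ₃ (:4 :* q) (:2 :* m) :+ con (+ 16) :* q :* (q :* (q :- m) :- z :* z))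
          refl q m z)
      }

  -- The weight e = m - 4 q is positive as μ > 2 l. The smaller weight 2 q - u is positive because 4
  -- q² - u² = q (8 q - m), so this family stops at m = 8 q, that is, at μ = 4 l.
  moderate⇒realizable : ∀ {q m l μ} → 4# * q ≈ l → 2# * m ≈ μ →
    0# < q → 4# * q < m → m < 8# * q →
    LaplacianRealizable ℝ K₄-e (0# ∷ l ∷ l ∷ μ ∷ [])
  moderate⇒realizable {q} {m} 4q≈l 2m≈μ 0<q 4q<m m<8q =
    let u , 0≤u , u²≈q[m-4q] = sqrt (inj₁ (*-pos 0<q (x<y⇒0<y-x 4q<m)))
        0<2q+u = +-pos-nonneg (*-pos 0<2 0<q) 0≤u
        0<2q-u = x-√y-pos (*-pos 0<2 0<q) 0≤u u²≈q[m-4q] (0<-resp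
          (solve 2 (λ q m → q :* (:8 :* q :- m) :=
            :2 :* q :* (:2 :* q) :- q :* (m :- :4 :* q)) refl q m)
          (*-pos 0<q (x<y⇒0<y-x m<8q)))
    in weights⇒realizable 0<2q-u 0<2q+u 0<2q-u 0<2q+u (x<y⇒0<y-x 4q<m)
         (HasCoefficients-cong 4q≈l 2m≈μ (coefficients u u²≈q[m-4q]))
    where
    coefficients : ∀ u → u * u ≈ q * (m - 4# * q) →
      WeightCoefficients (2# * q - u) (2# * q + u) (2# * q - u) (2# * q + u) (m - 4# * q)
        (4# * q) (2# * m)
    coefficients u u²≈ = record
      { e₁≈ = solve 3 (λ q m u →
          :w₁ (:2 :* q :- u) (:2 :* q :+ u) (:2 :* q :- u) (:2 :* q :+ u) (m :- :4 :* q) :=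
            :σ₁ (:4 :* q) (:2 :* m))
          refl q m u
      ; e₂≈ = modulo u²≈ (solve 3 (λ q m u →
          :w₂ (:2 :* q :- u) (:2 :* q :+ u) (:2 :* q :- u) (:2 :* q :+ u) (m :- :4 :* q) :=
            :σ₂ (:4 :* q) (:2 :* m) :+ :8 :* (q :* (m :- :4 :* q) :- u :* u))
          refl q m u)
      ; e₃≈ = modulo u²≈ (solve 3 (λ q m u →
          :w₃ (:2 :* q :- u) (:2 :* q :+ u) (:2 :* q :- u) (:2 :* q :+ u) (m :- :4 :* q) :=
            :σ₃ (:4 :* q) (:2 :* m) :+ con (+ 32) :* q :* (q :* (m :- :4 :* q) :- u :* u))
          refl q m u)
      }

  -- The squares s² and (q/s)² are the roots j + w and j - w of t² - 2 j t + q², which are real and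
  -- positive for j ≥ q. The vector is zero at vertex 3, so all edges there have weight q.
  large⇒realizable : ∀ {q j l μ} → 4# * q ≈ l → 4# * j + 6# * q ≈ μ →
    0# < q → q ≤ j → LaplacianRealizable ℝ K₄-e (0# ∷ l ∷ l ∷ μ ∷ [])
  large⇒realizable {q} {j} 4q≈l 4j+6q≈μ 0<q q≤j =
    let w , 0≤w , w²≈j²-q² = sqrt (0≤-resp
          (solve 2 (λ q j → (j :+ q) :* (j :- q) := j :* j :- q :* q) refl q j)
          (*-nonneg (inj₁ (+-pos 0<j 0<q)) (x≤y⇒0≤y-x q≤j)))
        0<j+w = +-pos-nonneg 0<j 0≤w
        0<j-w = x-√y-pos 0<j 0≤w w²≈j²-q² (0<-resp
          (solve 2 (λ q j → q :* q := j :* j :- (j :* j :- q :* q)) refl q j) (*-pos 0<q 0<q))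
    in weights⇒realizable (+-pos (*-pos 0<2 0<q) 0<j+w) 0<q (+-pos (*-pos 0<2 0<q) 0<j-w) 0<q 0<q
         (HasCoefficients-cong 4q≈l 4j+6q≈μ (coefficients w w²≈j²-q²))
    where
    0<j = <-≤-trans 0<q q≤j

    coefficients : ∀ w → w * w ≈ j * j - q * q →
      WeightCoefficients (2# * q + (j + w)) q (2# * q + (j - w)) q q
        (4# * q) (4# * j + 6# * q)
    coefficients w w²≈ = record
      { e₁≈ = solve 3 (λ q j w →
          :w₁ (:2 :* q :+ (j :+ w)) q (:2 :* q :+ (j :- w)) q q :=
            :σ₁ (:4 :* q) (:4 :* j :+ :6 :* q))
          refl q j w
      ; e₂≈ = modulo w²≈ (solve 3 (λ q j w →
          :w₂ (:2 :* q :+ (j :+ w)) q (:2 :* q :+ (j :- w)) q q :=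
            :σ₂ (:4 :* q) (:4 :* j :+ :6 :* q) :+ :3 :* (j :* j :- q :* q :- w :* w))
          refl q j w)
      ; e₃≈ = modulo w²≈ (solve 3 (λ q j w →
          :w₃ (:2 :* q :+ (j :+ w)) q (:2 :* q :+ (j :- w)) q q :=
            :σ₃ (:4 :* q) (:4 :* j :+ :6 :* q) :+ con (+ 12) :* q :* (j :* j :- q :* q :- w :* w))
          refl q j w)
      }

  bounds⇒realizable : ∀ {l μ} → 0# < l → 2# * l < μ ⊎ (0# < μ × μ ≤ 2# ⁻¹ * l) →
    LaplacianRealizable ℝ K₄-e (0# ∷ l ∷ l ∷ μ ∷ [])
  bounds⇒realizable {l} {μ} 0<l bounds =
    let q , 4q≈l = quotient 0<4 l
        m , 2m≈μ = quotient 0<2 μ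
        j , 4j≈μ-6q = quotient 0<4 (μ - 6# * q)
    in realize 4q≈l 2m≈μ 4j≈μ-6q (*-cancel-pos 0<4 (0<-resp (sym 4q≈l) 0<l)) bounds
    where
    realize : ∀ {q m j} → 4# * q ≈ l → 2# * m ≈ μ → 4# * j ≈ μ - 6# * q → 0# < q →
         2# * l < μ ⊎ (0# < μ × μ ≤ 2# ⁻¹ * l) →
         LaplacianRealizable ℝ K₄-e (0# ∷ l ∷ l ∷ μ ∷ [])
    realize {q} {m} 4q≈l 2m≈μ _ 0<q (inj₂ (0<μ , μ≤l/2)) = small⇒realizable 4q≈l 2m≈μ 0<q
      (*-cancel-pos 0<2 (0<-resp (sym 2m≈μ) 0<μ))
      (0≤y-x⇒x≤y (*-cancel-nonneg 0<4 (0≤-resp (begin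
        l - 2# * μ
          ≈⟨ +-cong 4q≈l (-‿cong (*-congˡ 2m≈μ)) ⟨
        4# * q - 2# * (2# * m)
          ≈⟨ solve 2 (λ q m → :4 :* q :- :2 :* (:2 :* m) :=
               :4 :* (q :- m)) refl q m ⟩
        4# * (q - m) ∎)
        (x≤y⇒0≤y-x (half-≤ μ≤l/2)))))
    realize {q} {m} {j} 4q≈l 2m≈μ 4j≈μ-6q 0<q (inj₁ 2l<μ) =
      -- The condition q ≤ j means 2 μ ≥ 5 l, so the two families overlap for μ from 5 l/2 up to 4
      -- l, and splitting at m = 8 q, where μ = 4 l, leaves no gap.
      [ moderate⇒realizable 4q≈l 2m≈μ 0<q 4q<m
      , (λ 8q≤m → large⇒realizable 4q≈l 4j+6q≈μ 0<q (q≤j 8q≤m))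
      ]′ (<-≤-connex m (8# * q))
      where
      4q<m : 4# * q < m
      4q<m = 0<y-x⇒x<y (*-cancel-pos 0<2 (0<-resp (begin
        μ - 2# * l
          ≈⟨ +-cong 2m≈μ (-‿cong (*-congˡ 4q≈l)) ⟨
        2# * m - 2# * (4# * q)
          ≈⟨ solve 2 (λ q m → :2 :* m :- :2 :* (:4 :* q) :=
               :2 :* (m :- :4 :* q)) refl q m ⟩
        2# * (m - 4# * q) ∎)
        (x<y⇒0<y-x 2l<μ)))

      4j+6q≈μ : 4# * j + 6# * q ≈ μ
      4j+6q≈μ = trans (+-congʳ 4j≈μ-6q)
        (solve 2 (λ q μ → μ :- :6 :* q :+ :6 :* q := μ) refl q μ)

      q≤j : 8# * q ≤ m → q ≤ j
      q≤j 8q≤m = 0≤y-x⇒x≤y (*-cancel-nonneg 0<4 (0≤-resp (begin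
        2# * (m - 8# * q) + (4# * q + 2# * q)
          ≈⟨ solve 2 (λ q m → :2 :* (m :- :8 :* q) :+ (:4 :* q :+ :2 :* q) :=
               :2 :* m :- :6 :* q :- :4 :* q) refl q m ⟩
        2# * m - 6# * q - 4# * q
          ≈⟨ +-congʳ (trans 4j≈μ-6q (+-congʳ (sym 2m≈μ))) ⟨
        4# * j - 4# * q
          ≈⟨ solve 2 (λ q j → :4 :* j :- :4 :* q := :4 :* (j :- q)) refl q j ⟩
        4# * (j - q) ∎)
        (+-nonneg (*-nonneg (inj₁ 0<2) (x≤y⇒0≤y-x 8q≤m))
          (inj₁ (+-pos (*-pos 0<4 0<q) (*-pos 0<2 0<q))))))

theorem3p15 : ∀ {c ℓ₁ ℓ₂} (ℝ : CompleteOrderedField c ℓ₁ ℓ₂) →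
    let open CompleteOrderedField ℝ in
    ∀ (λ₀ μ : Carrier) → 0# < λ₀ →
    LaplacianRealizable ℝ K₄-e (0# ∷ λ₀ ∷ λ₀ ∷ μ ∷ [])
    ⇔ (2# * λ₀ < μ ⊎ (0# < μ × μ ≤ 2# ⁻¹ * λ₀))
theorem3p15 ℝ λ₀ μ 0<λ₀ = mk⇔ (realizable⇒bounds ℝ 0<λ₀) (bounds⇒realizable ℝ 0<λ₀)
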